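{- Let $m\ge2$. If $\{B_i : 1\leq i\leq m\}$ is an $(n,m;k_1,k_2,\dots,k_m;\lambda_1,\lambda_2,\dots,\lambda_m)$-GSEDF, then $\{B_i : 1\leq i\leq m\}$ is an $(n,m,(k_1,k_2,\dots,k_m),a,\lambda)$-SWEDF, where $a=\sum_{i}k_i$, $\widetilde{k}=\mathrm{lcm}(k_1,\dots,k_m)$ and $\lambda=\sum_{1\leq i\leq m}\frac{\lambda_i\widetilde{k}}{k_i}$.
   Context: Let $G$ be an additive Abelian group of order $n$ with identity $0$. For multi-sets $B_1,B_2$ of elements of $G$, $D(B_1,B_2)$ is the multi-set $\{x-y : x\in B_1,\ y\in B_2\}$; $c\boxtimes B$ is the multi-set in which each element of $B$ is repeated $c$ times; unions are multi-set unions. Let $\mathcal{B}=\{B_i : 1\le i\le m\}$ be a family of pairwise disjoint nonempty subsets of $G$ with $k_i=|B_i|$. $\mathcal{B}$ is an $(n,m;k_1,\dots,k_m;\lambda_1,\dots,\lambda_m)$-generalized strong external difference family (GSEDF) if for each $1\le i\le m$, $\bigcup_{1\le j\le m,\ j\ne i}D(B_i,B_j)=\lambda_i\boxtimes(G\setminus\{0\})$. With $K=(k_1,\dots,k_m)$, $a=\sum_i k_i$, $\widetilde{k}=\mathrm{lcm}(k_1,\dots,k_m)$ and $\widetilde{B}_i=\frac{\widetilde{k}}{k_i}\boxtimes B_i$, $\mathcal{B}$ is an $(n,m,K,a,\lambda)$-SWEDF (standard weighted external difference family), $\lambda$ a positive integer, if $\bigcup_{1\le i\ne j\le m}D(B_i,\widetilde{B}_j)=\lambda\boxtimes(G\setminus\{0\})$.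 -}

module Defs where

open import Algebra.Bundles using (AbelianGroup)
open import Data.Fin.Base using (Fin)
open import Data.Fin.Properties using (_≟_)
open import Data.List.Base
  using (List; []; allFin; cartesianProduct; cartesianProductWith; concatMap;
         filter; length; map; replicate)
open import Data.Nat.Base using (ℕ; NonZero; _<_; _/_)
open import Data.Nat.LCM using (lcm)
open import Data.Nat.Properties using (+-*-semiring)
open import Data.Product.Base using (_,_)
open import Data.Vec.Functional using (Vector; foldr)
open import Function.Bundles using (Inverse)
open import Function.Properties.Inverse using (Inverse⇒Injection)
open import Level using (Level; _⊔_)
open import Relation.Binary.Definitions using (Decidable)
open import Relation.Binary.PropositionalEquality using (_≡_; _≢_; setoid)
open import Relation.Nullary.Decidable using (¬?; via-injection)

open import Algebra.Properties.Semiring.Sum +-*-semiring public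
  using (sum; sum-syntax)

import Data.List.Relation.Binary.Disjoint.Setoid as DisjointSetoid
import Data.List.Relation.Binary.Permutation.Setoid as PermutationSetoid
import Data.List.Relation.Unary.Unique.Setoid as UniqueSetoid

lcms : ∀ {m} → Vector ℕ m → ℕ
lcms = foldr lcm 1

HasOrder : ∀ {c ℓ} → AbelianGroup c ℓ → ℕ → Set (c ⊔ ℓ)
HasOrder G n = Inverse (AbelianGroup.setoid G) (setoid (Fin n))

-- A multi-set of elements of G is a list; equality of multi-sets is _↭_,
-- permutation up to the equality of G. A subset is a repetition-free list.

module _ {c ℓ : Level} (G : AbelianGroup c ℓ) {n : ℕ} (order : HasOrder G n) where

  open AbelianGroup G
    renaming (Carrier to A; setoid to G-setoid; ε to 0#) using (_≈_; _-_)
  open DisjointSetoid G-setoid using (Disjoint)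
  open PermutationSetoid G-setoid using (_↭_)
  open UniqueSetoid G-setoid using (Unique)

  _≈?_ : Decidable _≈_
  _≈?_ = via-injection (Inverse⇒Injection order) _≟_

  G∖0 : List A
  G∖0 = filter (λ x → ¬? (x ≈? 0#)) (map (Inverse.from order) (allFin n))

  D : List A → List A → List A
  D = cartesianProductWith _-_

  infixr 7 _⊠_
  _⊠_ : ℕ → List A → List A
  c ⊠ B = concatMap (replicate c) B

  record IsDisjointFamily {m} (k : Vector ℕ m) (B : Vector (List A) m)
         : Set (c ⊔ ℓ) where
    field
      unique   : ∀ i → Unique (B i)
      nonempty : ∀ i → B i ≢ []
      disjoint : ∀ i j → i ≢ j → Disjoint (B i) (B j)
      size     : ∀ i → length (B i) ≡ k i

  record IsGSEDF {m} (k λs : Vector ℕ m) (B : Vector (List A) m)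
         : Set (c ⊔ ℓ) where
    field
      isDisjointFamily : IsDisjointFamily k B
      differences      : ∀ i →
        concatMap (λ j → D (B i) (B j)) (filter (λ j → ¬? (j ≟ i)) (allFin m))
          ↭ λs i ⊠ G∖0

  -- k≢0 already follows from nonempty and size; it is there for _/_, and the
  -- division in B̃ is exact, since k j divides lcms k.
  record IsSWEDF {m} (k : Vector ℕ m) ⦃ k≢0 : ∀ {i} → NonZero (k i) ⦄
                 (a λ′ : ℕ) (B : Vector (List A) m) : Set (c ⊔ ℓ) where

    B̃ : Vector (List A) m
    B̃ j = (lcms k / k j) ⊠ B j

    field
      isDisjointFamily : IsDisjointFamily k B
      total            : a ≡ sum k
      positive         : 0 < λ′
      differences      :
        concatMap (λ (i , j) → D (B i) (B̃ j))
                  (filter (λ (i , j) → ¬? (i ≟ j))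
                          (cartesianProduct (allFin m) (allFin m)))
          ↭ λ′ ⊠ G∖0

{-# OPTIONS --safe #-}

-- Negation maps D (B j) (B i) onto D (B i) (B j) and permutes G ∖ {0}. Negating
-- the j-th GSEDF identity, repeating it k̃ / k j times and summing over j gives
-- the SWEDF identity, once its double union is grouped by the second index j.
-- Unions are sums in the commutative monoid of lists up to permutation.

module Submission where

open import Defs
open import Algebra.Bundles using (AbelianGroup; CommutativeMonoid)
open import Data.Bool.Base using (true; false; if_then_else_)
open import Data.Bool.Properties using (if-float)
open import Data.Fin.Base using (Fin; zero; suc)
open import Data.Fin.Permutation using (Permutation; permutation)
open import Data.Fin.Properties using (_≟_)
open import Data.List.Base
  using (List; []; _∷_; [_]; _++_; allFin; cartesianProduct;
         cartesianProductWith; concatMap; filter; map; replicate; tabulate)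
open import Data.List.Properties
  using (cartesianProductWith-distribʳ-++; concatMap-++; concatMap-cong;
         concatMap-map; concatMap-pure; map-++)
open import Data.Nat.Base
  using (ℕ; zero; suc; NonZero; _≤_; _<_; s≤s; _*_; _/_; >-nonZero)
open import Data.Nat.Divisibility using (_∣_; ∣-trans; ∣⇒≤)
open import Data.Nat.DivMod using (*-/-assoc; m≥n⇒m/n>0)
open import Data.Nat.GCD using (gcd)
open import Data.Nat.LCM using (lcm; gcd*lcm; m∣lcm[m,n]; n∣lcm[m,n])
open import Data.Nat.Properties
  using (+-*-semiring; *-comm; m*n≢0; m*n≢0⇒n≢0; m≤n⇒m≤o*n; m≤m+n; <-≤-trans; n≢0⇒n>0)
open import Data.Product.Base using (_,_)
open import Data.Vec.Functional using (Vector)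
open import Function.Base using (_∘_; flip; id)
open import Function.Bundles using (Inverse)
open import Level using (Level)
open import Relation.Binary.Bundles using (Setoid)
open import Relation.Binary.PropositionalEquality
  using (_≡_; _≢_; refl; sym; trans; cong; cong₂; subst; module ≡-Reasoning)
open import Relation.Nullary.Decidable using (Dec; ¬?; does; yes; no)
open import Relation.Nullary.Negation using (¬_; contradiction)
open import Relation.Unary using (Pred; Decidable)

open import Algebra.Properties.Semiring.Sum +-*-semiring using (sum-cong-≗)

import Algebra.Properties.AbelianGroup as AbelianGroupProperties
import Algebra.Properties.CommutativeMonoid.Mult as CommutativeMonoidMult
import Algebra.Properties.CommutativeMonoid.Sum as CommutativeMonoidSum
import Data.List.Relation.Binary.Equality.Setoid as ListEquality
import Data.List.Relation.Binary.Permutation.Setoid as PermutationSetoid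
import Data.List.Relation.Binary.Permutation.Setoid.Properties
  as PermutationProperties

private
  variable
    a b c p ℓ : Level
    A : Set a
    B : Set b
    C : Set c

-- Least common multiples and concatenation over filtered lists.

lcm≢0 : ∀ m n → .⦃ NonZero m ⦄ → .⦃ NonZero n ⦄ → NonZero (lcm m n)
lcm≢0 m n = m*n≢0⇒n≢0 (gcd m n) ⦃ subst NonZero (sym (gcd*lcm m n)) (m*n≢0 m n) ⦄

-- Turns the divisibility `k i ∣ lcms k` into an inequality when positivity is proved; the fold
-- starts at 1, which settles the empty vector.
lcms≢0 : ∀ {m} (k : Vector ℕ m) → (∀ i → NonZero (k i)) → NonZero (lcms k)
lcms≢0 {zero}  k k≢0 = _
lcms≢0 {suc m} k k≢0 =
  lcm≢0 (k zero) _ ⦃ k≢0 zero ⦄ ⦃ lcms≢0 (k ∘ suc) (k≢0 ∘ suc) ⦄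

∣lcms : ∀ {m} (k : Vector ℕ m) i → k i ∣ lcms k
∣lcms k zero    = m∣lcm[m,n] (k zero) _
∣lcms k (suc i) = ∣-trans (∣lcms (k ∘ suc) i) (n∣lcm[m,n] (k zero) _)

-- Excluded indices become empty summands, so a restricted union turns into a sum over the full
-- index set, where sums can be interchanged and reindexed.
concatMap-filter : ∀ {P : Pred A p} (P? : Decidable P) (f : A → List B) xs →
  concatMap f (filter P? xs) ≡
  concatMap (λ x → if does (P? x) then f x else []) xs
concatMap-filter P? f []       = refl
concatMap-filter P? f (x ∷ xs) with does (P? x)
... | true  = cong (f x ++_) (concatMap-filter P? f xs)
... | false = concatMap-filter P? f xs

concatMap-cartesianProduct : ∀ (f : A → B → List C) xs ys →
  concatMap (λ (x , y) → f x y) (cartesianProduct xs ys) ≡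
  concatMap (λ x → concatMap (f x) ys) xs
concatMap-cartesianProduct f []       ys = refl
concatMap-cartesianProduct f (x ∷ xs) ys = trans
  (concatMap-++ _ (map (x ,_) ys) _)
  (cong₂ _++_ (concatMap-map _ (x ,_) ys) (concatMap-cartesianProduct f xs ys))

-- Multiples and finite sums in a commutative monoid.

module _ (M : CommutativeMonoid c ℓ) where
  open CommutativeMonoid M
    renaming (Carrier to X; refl to ≈-refl; sym to ≈-sym; trans to ≈-trans)
  open CommutativeMonoidSum M using () renaming (sum to ∑)
  open CommutativeMonoidMult M using (×-homo-+; ×-distrib-+) renaming (_×_ to _·_)

  ×-homo-sum : ∀ {n} (f : Vector ℕ n) x → ∑ (λ i → f i · x) ≈ sum f · x
  ×-homo-sum {zero}  f x = ≈-refl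
  ×-homo-sum {suc n} f x = ≈-trans
    (∙-congˡ (×-homo-sum (f ∘ suc) x))
    (≈-sym (×-homo-+ x (f zero) _))

  ×-zeroʳ : ∀ n → n · ε ≈ ε
  ×-zeroʳ zero    = ≈-refl
  ×-zeroʳ (suc n) = ≈-trans (identityˡ _) (×-zeroʳ n)

  ×-distrib-sum : ∀ n {m} (f : Vector X m) → n · ∑ f ≈ ∑ (λ i → n · f i)
  ×-distrib-sum n {zero}  f = ×-zeroʳ n
  ×-distrib-sum n {suc m} f = ≈-trans
    (×-distrib-+ (f zero) _ n)
    (∙-congˡ (×-distrib-sum n (f ∘ suc)))

-- Lists up to permutation as a commutative monoid.

module _ (S : Setoid c ℓ) where
  open Setoid S using (_≈_) renaming (Carrier to X)
  open PermutationSetoid S hiding (refl; prep; swap; trans)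
  open PermutationProperties S hiding (map⁺)
  open CommutativeMonoidSum ++-commutativeMonoid using () renaming (sum to ⨄)
  open CommutativeMonoidMult ++-commutativeMonoid
    using (×-distrib-+) renaming (_×_ to _·_)
  open ListEquality S using (_≋_; []; _∷_)
    renaming (++⁺ to ≋-++⁺)

  concatMap-tabulate : ∀ {n} (f : A → List X) (g : Fin n → A) →
    concatMap f (tabulate g) ≡ ⨄ (f ∘ g)
  concatMap-tabulate {n = zero}  f g = refl
  concatMap-tabulate {n = suc n} f g =
    cong (f (g zero) ++_) (concatMap-tabulate f (g ∘ suc))

  map-⨄ : ∀ (h : X → X) {n} (f : Vector (List X) n) → map h (⨄ f) ≡ ⨄ (map h ∘ f)
  map-⨄ h {zero}  f = refl
  map-⨄ h {suc n} f =
    trans (map-++ h (f zero) _) (cong (map h (f zero) ++_) (map-⨄ h (f ∘ suc)))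

  map-· : ∀ (h : X → X) n xs → map h (n · xs) ≡ n · map h xs
  map-· h zero    xs = refl
  map-· h (suc n) xs = trans (map-++ h xs _) (cong (map h xs ++_) (map-· h n xs))

  if-· : ∀ b c {xs ys} → xs ↭ c · ys →
    (if b then xs else []) ↭ c · (if b then ys else [])
  if-· true  c xs↭ys = xs↭ys
  if-· false c _     = ↭-sym (×-zeroʳ ++-commutativeMonoid c)

  -- Links two forms of repetition: the left side repeats each entry in place, while `c · xs`
  -- appends `c` whole copies of `xs`. The copies of the head are gathered by distributivity.
  concatMap-replicate : ∀ c xs → concatMap (replicate c) xs ↭ c · xs
  concatMap-replicate c []       = ↭-sym (×-zeroʳ ++-commutativeMonoid c)
  concatMap-replicate c (x ∷ xs) = ↭-trans
    (++⁺ (↭-reflexive (replicate-· c)) (concatMap-replicate c xs))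
    (↭-sym (×-distrib-+ [ x ] xs c))
    where
    replicate-· : ∀ c → replicate c x ≡ c · [ x ]
    replicate-· zero    = refl
    replicate-· (suc c) = cong (x ∷_) (replicate-· c)

  cartesianProductWith-replicate : ∀ (f : A → B → X) c xs ys →
    cartesianProductWith f (concatMap (replicate c) xs) ys ↭
    c · cartesianProductWith f xs ys
  cartesianProductWith-replicate f c []       ys = ↭-sym (×-zeroʳ ++-commutativeMonoid c)
  cartesianProductWith-replicate f c (x ∷ xs) ys = begin
    cartesianProductWith f (replicate c x ++ concatMap (replicate c) xs) ys
      ≡⟨ cartesianProductWith-distribʳ-++ f (replicate c x) _ ys ⟩
    cartesianProductWith f (replicate c x) ys ++
    cartesianProductWith f (concatMap (replicate c) xs) ys
      ↭⟨ ++⁺ (↭-reflexive (row c)) (cartesianProductWith-replicate f c xs ys) ⟩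
    c · map (f x) ys ++ c · cartesianProductWith f xs ys
      ↭⟨ ×-distrib-+ (map (f x) ys) _ c ⟨
    c · cartesianProductWith f (x ∷ xs) ys ∎
    where
    open PermutationReasoning
    row : ∀ c → cartesianProductWith f (replicate c x) ys ≡ c · map (f x) ys
    row zero    = refl
    row (suc c) = cong (map (f x) ys ++_) (row c)

  -- The product is listed row by row, so the entries for `y` are spread over all rows; `shifts`
  -- carries them to the front past one row at a time.
  cartesianProductWith-∷ʳ : ∀ (f : A → B → X) xs y ys →
    cartesianProductWith f xs (y ∷ ys) ↭
    map (flip f y) xs ++ cartesianProductWith f xs ys
  cartesianProductWith-∷ʳ f []       y ys = ↭-refl
  cartesianProductWith-∷ʳ f (x ∷ xs) y ys = ↭-prep (f x y) (↭-trans
    (++⁺ˡ (map (f x) ys) (cartesianProductWith-∷ʳ f xs y ys))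
    (shifts (map (f x) ys) (map (flip f y) xs)))

  cartesianProductWith-flip : ∀ (f : A → B → X) xs ys →
    cartesianProductWith f xs ys ↭ cartesianProductWith (flip f) ys xs
  cartesianProductWith-flip f xs []       =
    ↭-reflexive (cartesianProductWith-zero xs)
    where
    cartesianProductWith-zero : ∀ xs → cartesianProductWith f xs [] ≡ []
    cartesianProductWith-zero []       = refl
    cartesianProductWith-zero (x ∷ xs) = cartesianProductWith-zero xs
  cartesianProductWith-flip f xs (y ∷ ys) = ↭-trans
    (cartesianProductWith-∷ʳ f xs y ys)
    (++⁺ˡ (map (flip f y) xs) (cartesianProductWith-flip f xs ys))

  map-cartesianProductWith : ∀ (h : X → X) (f g : A → B → X) →
    (∀ x y → h (f x y) ≈ g x y) → ∀ xs ys →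
    map h (cartesianProductWith f xs ys) ≋ cartesianProductWith g xs ys
  map-cartesianProductWith h f g h∘f≈g []       ys = []
  map-cartesianProductWith h f g h∘f≈g (x ∷ xs) ys
    rewrite map-++ h (map (f x) ys) (cartesianProductWith f xs ys) =
    ≋-++⁺ (row ys) (map-cartesianProductWith h f g h∘f≈g xs ys)
    where
    row : ∀ ys → map h (map (f x) ys) ≋ map (g x) ys
    row []       = []
    row (y ∷ ys) = h∘f≈g x y ∷ row ys

-- Negation in `G` and difference multi-sets.

module _ (G : AbelianGroup c ℓ) {n : ℕ} (order : HasOrder G n) where
  open AbelianGroup G
    renaming (Carrier to X; setoid to G-setoid; ε to 0#; _⁻¹ to neg;
              ⁻¹-cong to neg-cong; refl to ≈-refl; sym to ≈-sym; trans to ≈-trans)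
    using (_≈_; _-_)
  open AbelianGroupProperties G
    using (⁻¹-involutive; ε⁻¹≈ε; ⁻¹-anti-homo‿-)
  open PermutationSetoid G-setoid hiding (refl; swap; trans)
  open PermutationProperties G-setoid
  open CommutativeMonoidSum ++-commutativeMonoid
    using (sum-cong-≋; ∑-comm; sum-permute) renaming (sum to ⨄)
  open CommutativeMonoidMult ++-commutativeMonoid
    using (×-congʳ; ×-congˡ; ×-assocˡ) renaming (_×_ to _·_)
  open Inverse order using (to; from; to-cong; strictlyInverseˡ; strictlyInverseʳ)

  private
    -- The contribution of a single element to `G⁎`, which makes `G⁎` a sum over `Fin n` that a
    -- permutation of the indices preserves.
    _∖0 : X → List X
    x ∖0 = if does (¬? (_≈?_ G order x 0#)) then [ x ] else []

    G⁎ : List X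
    G⁎ = G∖0 G order

    Δ : List X → List X → List X
    Δ = D G order

  G∖0≡⨄ : G⁎ ≡ ⨄ (_∖0 ∘ from)
  G∖0≡⨄ = begin
    G⁎                                  ≡⟨ concatMap-pure G⁎ ⟨
    concatMap [_] G⁎                    ≡⟨ concatMap-filter _ [_] (map from (allFin n)) ⟩
    concatMap _∖0 (map from (allFin n)) ≡⟨ concatMap-map _∖0 from (allFin n) ⟩
    concatMap (_∖0 ∘ from) (allFin n)   ≡⟨ concatMap-tabulate G-setoid (_∖0 ∘ from) id ⟩
    ⨄ (_∖0 ∘ from)                      ∎
    where open ≡-Reasoning

  -- Group negation carried over to indices by the enumeration of `G`; as an involution it is its
  -- own inverse.
  negation : Permutation n n
  negation = permutation σ σ σ-involutive σ-involutive
    where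
    σ : Fin n → Fin n
    σ i = to (neg (from i))
    σ-involutive : ∀ i → σ (σ i) ≡ i
    σ-involutive i = trans
      (to-cong (≈-trans (neg-cong (strictlyInverseʳ _)) (⁻¹-involutive _)))
      (strictlyInverseˡ i)

  -- Negation fixes 0 and is involutive, so `x` and `y` are zero together. A general `y` is allowed
  -- because `from (to (neg x))` equals `neg x` only up to `≈`.
  map-neg-∖0 : ∀ {x y} → y ≈ neg x → map neg (x ∖0) ↭ y ∖0
  map-neg-∖0 {x} {y} y≈-x = go (_≈?_ G order x 0#) (_≈?_ G order y 0#)
    where
    -- Taking both decisions as arguments lets one case split reduce both conditionals.
    go : (x≈0? : Dec (x ≈ 0#)) (y≈0? : Dec (y ≈ 0#)) →
      map neg (if does (¬? x≈0?) then [ x ] else []) ↭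
      (if does (¬? y≈0?) then [ y ] else [])
    go (yes _)   (yes _)   = ↭-refl
    go (no _)    (no _)    = prep (≈-sym y≈-x) ↭-refl
    go (yes x≈0) (no y≉0)  =
      contradiction (≈-trans y≈-x (≈-trans (neg-cong x≈0) ε⁻¹≈ε)) y≉0
    go (no x≉0)  (yes y≈0) = contradiction
      (≈-trans (≈-sym (⁻¹-involutive x))
        (≈-trans (neg-cong (≈-trans (≈-sym y≈-x) y≈0)) ε⁻¹≈ε)) x≉0

  map-neg-G∖0 : map neg G⁎ ↭ G⁎
  map-neg-G∖0 = begin
    map neg G⁎                            ≡⟨ cong (map neg) G∖0≡⨄ ⟩
    map neg (⨄ (_∖0 ∘ from))              ≡⟨ map-⨄ G-setoid neg (_∖0 ∘ from) ⟩
    ⨄ (map neg ∘ _∖0 ∘ from)              ↭⟨ sum-cong-≋ {n} (λ i → map-neg-∖0 {from i} (strictlyInverseʳ _)) ⟩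
    ⨄ (λ i → from (to (neg (from i))) ∖0) ↭⟨ sum-permute (_∖0 ∘ from) negation ⟨
    ⨄ (_∖0 ∘ from)                        ≡⟨ G∖0≡⨄ ⟨
    G⁎                                    ∎
    where open PermutationReasoning

  -- Rests on `x - y ≈ neg (y - x)`. Exchanging the factors moves the repeated list to the first
  -- position, where each repetition yields a whole row.
  D-⊠ʳ : ∀ c xs ys → Δ xs (_⊠_ G order c ys) ↭ c · map neg (Δ ys xs)
  D-⊠ʳ c xs ys = begin
    Δ xs (_⊠_ G order c ys)
      ↭⟨ cartesianProductWith-flip G-setoid _-_ xs _ ⟩
    cartesianProductWith (flip _-_) (_⊠_ G order c ys) xs
      ↭⟨ cartesianProductWith-replicate G-setoid (flip _-_) c ys xs ⟩
    c · cartesianProductWith (flip _-_) ys xs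
      ↭⟨ ×-congʳ c (↭-reflexive-≋ (map-cartesianProductWith G-setoid neg _-_ (flip _-_) ⁻¹-anti-homo‿- ys xs)) ⟨
    c · map neg (Δ ys xs) ∎
    where open PermutationReasoning

  ¬D↭[] : ∀ {xs ys zs} → xs ≢ [] → ys ≢ [] → ¬ (Δ xs ys ++ zs ↭ [])
  ¬D↭[] {[]}            xs≢[] _     _ = xs≢[] refl
  ¬D↭[] {_ ∷ _} {[]}    _     ys≢[] _ = ys≢[] refl
  ¬D↭[] {_ ∷ _} {_ ∷ _} _     _       = ¬x∷xs↭[]

  -- The weighted double union.

  module _ {m} {k λs : Vector ℕ m} {B : Vector (List X) m}
           (gsedf : IsGSEDF G order k λs B) where
    open IsGSEDF gsedf
    open PermutationReasoning

    -- The weight depends on the second index alone, so for fixed `j` it factors out of the union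
    -- over `i`, leaving the negated GSEDF identity at `j`. The theorem takes `w j` to be
    -- `lcms k / k j`.
    weighted-differences : ∀ (w : Vector ℕ m) →
      concatMap (λ (i , j) → Δ (B i) (_⊠_ G order (w j) (B j)))
                (filter (λ (i , j) → ¬? (i ≟ j))
                        (cartesianProduct (allFin m) (allFin m)))
        ↭ _⊠_ G order (∑[ j < m ] (w j * λs j)) G⁎
    weighted-differences w = begin
      concatMap (λ (i , j) → Δ (B i) (_⊠_ G order (w j) (B j)))
                (filter (λ (i , j) → ¬? (i ≟ j))
                        (cartesianProduct (allFin m) (allFin m)))
        ≡⟨ concatMap-filter (λ (i , j) → ¬? (i ≟ j)) _ (cartesianProduct (allFin m) (allFin m)) ⟩
      concatMap (λ (i , j) → F i j) (cartesianProduct (allFin m) (allFin m))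
        ≡⟨ concatMap-cartesianProduct F (allFin m) (allFin m) ⟩
      concatMap (λ i → concatMap (F i) (allFin m)) (allFin m)
        ≡⟨ concatMap-cong (λ i → concatMap-tabulate G-setoid (F i) id) (allFin m) ⟩
      concatMap (λ i → ⨄ (F i)) (allFin m)
        ≡⟨ concatMap-tabulate G-setoid (λ i → ⨄ (F i)) id ⟩
      ⨄ (λ i → ⨄ (λ j → F i j))
        -- The outer index becomes `j`, the one that carries the weight.
        ↭⟨ ∑-comm F ⟩
      ⨄ (λ j → ⨄ (λ i → F i j))
        ↭⟨ sum-cong-≋ column ⟩
      ⨄ (λ j → (w j * λs j) · G⁎)
        ↭⟨ ×-homo-sum ++-commutativeMonoid (λ j → w j * λs j) G⁎ ⟩
      (∑[ j < m ] (w j * λs j)) · G⁎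
        ↭⟨ concatMap-replicate G-setoid _ G⁎ ⟨
      _⊠_ G order (∑[ j < m ] (w j * λs j)) G⁎ ∎
      where
      -- Both are empty on the diagonal. `E` has the two sets exchanged, so that summing it over `i`
      -- gives the left side of the GSEDF identity at `j`.
      F E : Fin m → Fin m → List X
      F i j = if does (¬? (i ≟ j)) then Δ (B i) (_⊠_ G order (w j) (B j)) else []
      E i j = if does (¬? (i ≟ j)) then Δ (B j) (B i) else []

      F↭E : ∀ i j → F i j ↭ w j · map neg (E i j)
      F↭E i j = begin
        F i j
          ↭⟨ if-· G-setoid (does (¬? (i ≟ j))) (w j) (D-⊠ʳ (w j) (B i) (B j)) ⟩
        w j · (if does (¬? (i ≟ j)) then map neg (Δ (B j) (B i)) else [])
          ≡⟨ cong (w j ·_) (if-float (map neg) (does (¬? (i ≟ j)))) ⟨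
        w j · map neg (E i j) ∎

      ⨄E↭ : ∀ j → ⨄ (λ i → E i j) ↭ λs j · G⁎
      ⨄E↭ j = begin
        ⨄ (λ i → E i j)
          ≡⟨ concatMap-tabulate G-setoid (λ i → E i j) id ⟨
        concatMap (λ i → E i j) (allFin m)
          ≡⟨ concatMap-filter (λ i → ¬? (i ≟ j)) _ (allFin m) ⟨
        concatMap (λ i → Δ (B j) (B i)) (filter (λ i → ¬? (i ≟ j)) (allFin m))
          ↭⟨ differences j ⟩
        _⊠_ G order (λs j) G⁎
          ↭⟨ concatMap-replicate G-setoid (λs j) G⁎ ⟩
        λs j · G⁎ ∎

      column : ∀ j → ⨄ (λ i → F i j) ↭ (w j * λs j) · G⁎
      column j = begin
        ⨄ (λ i → F i j)
          ↭⟨ sum-cong-≋ (λ i → F↭E i j) ⟩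
        ⨄ (λ i → w j · map neg (E i j))
          ↭⟨ ×-distrib-sum ++-commutativeMonoid (w j) (λ i → map neg (E i j)) ⟨
        w j · ⨄ (λ i → map neg (E i j))
          ≡⟨ cong (w j ·_) (map-⨄ G-setoid neg (λ i → E i j)) ⟨
        w j · map neg (⨄ (λ i → E i j))
          ↭⟨ ×-congʳ (w j) (map⁺ G-setoid neg-cong (⨄E↭ j)) ⟩
        w j · map neg (λs j · G⁎)
          ≡⟨ cong (w j ·_) (map-· G-setoid neg (λs j) G⁎) ⟩
        w j · (λs j · map neg G⁎)
          ↭⟨ ×-congʳ (w j) (×-congʳ (λs j) map-neg-G∖0) ⟩
        w j · (λs j · G⁎)
          ↭⟨ ×-assocˡ G⁎ (w j) (λs j) ⟩
        (w j * λs j) · G⁎ ∎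

  -- Positivity of the multiplicity and assembly of the SWEDF.

  λ₀>0 : ∀ {m} {k λs : Vector ℕ (suc (suc m))} {B} →
    IsGSEDF G order k λs B → 0 < λs zero
  λ₀>0 {λs = λs} {B} gsedf = n≢0⇒n>0 λ λ₀≡0 →
    -- With `zero` filtered out, the index list starts at `suc zero`, so the union begins with the
    -- differences of two nonempty sets; a zero multiplicity would make it empty.
    ¬D↭[] {B zero} (nonempty zero) (nonempty (suc zero)) (↭-trans
      (differences zero)
      (↭-trans (concatMap-replicate G-setoid (λs zero) G⁎) (×-congˡ λ₀≡0)))
    where
    open IsGSEDF gsedf
    open IsDisjointFamily isDisjointFamily

lemma5 : ∀ {c ℓ} (G : AbelianGroup c ℓ) (n : ℕ) (order : HasOrder G n)
    (m : ℕ) → 2 ≤ m →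
    (k : Vector ℕ m) ⦃ k≢0 : ∀ {i} → NonZero (k i) ⦄
    (λs : Vector ℕ m) (B : Vector (List (AbelianGroup.Carrier G)) m) →
    IsGSEDF G order k λs B →
    IsSWEDF G order k (sum k) (∑[ i < m ] ((λs i * lcms k) / k i)) B
lemma5 G n order m@(suc (suc _)) (s≤s (s≤s _)) k ⦃ k≢0 ⦄ λs B gsedf = record
  { isDisjointFamily = IsGSEDF.isDisjointFamily gsedf
  ; total            = refl
  -- The sum unfolds to its first summand plus a natural number, so one positive summand suffices.
  ; positive         = <-≤-trans first-positive (m≤m+n _ _)
  ; differences      = ↭-trans
      (weighted-differences G order gsedf (λ j → lcms k / k j))
      (↭-reflexive (cong (λ l → _⊠_ G order l (G∖0 G order))
                         (sum-cong-≗ weight)))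
  }
  where
  open PermutationSetoid (AbelianGroup.setoid G) using (↭-trans; ↭-reflexive)

  first-positive : 0 < (λs zero * lcms k) / k zero
  -- The numerator is at least the divisor: `k zero ≤ lcms k ≤ λs zero * lcms k`, the last because
  -- `λs zero` is positive.
  first-positive = m≥n⇒m/n>0 (m≤n⇒m≤o*n (λs zero)
    ⦃ >-nonZero (λ₀>0 G order gsedf) ⦄
    (∣⇒≤ ⦃ lcms≢0 k (λ i → k≢0 {i}) ⦄ (∣lcms k zero)))

  -- Floor division commutes with the factor `λs j` here because `k j` divides `lcms k` exactly.
  weight : ∀ j → (lcms k / k j) * λs j ≡ (λs j * lcms k) / k j
  weight j = trans (*-comm _ (λs j)) (sym (*-/-assoc (λs j) (∣lcms k j)))
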